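{- Let $t$ be a positive integer and let $M_1,M_2$ be matroids on a finite set $E$ such that $M_2$ is a quotient of $M_1$, and let $\rho=r_{M_1}+r_{M_2}$. Then $r(M_1)-r(M_2)\le t$ if and only if the polymatroid $\rho$ does not have the (rank function of the) uniform matroid $U_{t+1,t+1}$ as a minor.
   Context: A polymatroid on $E$ is a function $\rho:2^E\to\mathbb{Z}$ that is normalized, non-decreasing and submodular; matroid rank functions are polymatroids. For matroids $Q,L$ on $E$, $Q$ is a quotient of $L$ if there is a matroid $M$ and $A\subseteq E(M)$ with $L=M\backslash A$ and $Q=M/A$. Polymatroid minors: $\rho_{\backslash A}(X)=\rho(X)$, $\rho_{/A}(X)=\rho(X\cup A)-\rho(A)$ for $X\subseteq E-A$; minors are $(\rho_{\backslash A})_{/B}$ for disjoint $A,B\subseteq E$ (up to isomorphism). $U_{t+1,t+1}$ is the free matroid on $t+1$ elements, whose rank function is $X\mapsto|X|$. -}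

module Defs where

open import Data.Bool using (_∨_; _∧_)
open import Data.Nat as ℕ using (ℕ; suc)
import Data.Nat.Properties as ℕ
open import Data.Integer using (ℤ; +_; 0ℤ; +≤+; _+_; _-_; -_; _≤_)
open import Data.Integer.Properties
open import Data.Integer.Tactic.RingSolver using (solve-∀)
open import Data.Fin.Permutation using (Permutation; _⟨$⟩ˡ_)
open import Data.Fin.Subset
  using (Subset; inside; outside; ⊥; ∁; _∪_; _∩_; _⊆_; ∣_∣)
open import Data.Fin.Subset.Properties
  using (∪-identityˡ; ∪-distribʳ-∩; ∪-assoc; ∪-comm; ∪-idem;
         drop-∷-⊆; ∣⊥∣≡0; p⊆q⇒∣p∣≤∣q∣; x∈p∪q⁻; x∈p∪q⁺)
open import Data.Product using (∃-syntax; _×_; _,_)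
open import Data.Sum using (map₁)
open import Data.Vec using ([]; _∷_; here; there; lookup; tabulate)
open import Relation.Binary.PropositionalEquality

private variable
  m n : ℕ

-- The ground set of size n is Fin n, and its power set is Subset n.

record IsPolymatroid (ρ : Subset n → ℤ) : Set where
  field
    normalized    : ρ ⊥ ≡ 0ℤ
    nonDecreasing : ∀ X Y → X ⊆ Y → ρ X ≤ ρ Y
    submodular    : ∀ X Y → ρ (X ∪ Y) + ρ (X ∩ Y) ≤ ρ X + ρ Y

record Polymatroid (n : ℕ) : Set where
  field
    rank          : Subset n → ℤ
    isPolymatroid : IsPolymatroid rank
  open IsPolymatroid isPolymatroid public

open Polymatroid using (rank)

-- A matroid is given by its rank function.  The usual axiom
-- 0 ≤ r X ≤ ∣ X ∣ is split into `subcardinal` and normalization: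
-- r ⊥ ≡ 0 together with monotonicity gives 0 ≤ r X.
record Matroid (n : ℕ) : Set where
  field
    polymatroid : Polymatroid n
    subcardinal : ∀ X → rank polymatroid X ≤ + ∣ X ∣

open Matroid public using (polymatroid)

r : Matroid n → Subset n → ℤ
r M = rank (polymatroid M)

------------------------------------------------------------------------

infixl 6 _⊕_

_⊕_ : Polymatroid n → Polymatroid n → Polymatroid n
ρ ⊕ σ = record
  { rank          = λ X → rank ρ X + rank σ X
  ; isPolymatroid = record
    { normalized    = cong₂ _+_ ρ.normalized σ.normalized
    ; nonDecreasing = λ X Y X⊆Y →
        +-mono-≤ (ρ.nonDecreasing X Y X⊆Y) (σ.nonDecreasing X Y X⊆Y)
    ; submodular    = λ X Y →
        subst₂ _≤_
          (interchange (ρ.rank (X ∪ Y)) (ρ.rank (X ∩ Y)) _ _)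
          (interchange (ρ.rank X) (ρ.rank Y) _ _)
          (+-mono-≤ (ρ.submodular X Y) (σ.submodular X Y))
    }
  }
  where
  module ρ = Polymatroid ρ
  module σ = Polymatroid σ
  interchange : ∀ a b c d → (a + b) + (c + d) ≡ (a + c) + (b + d)
  interchange = solve-∀

------------------------------------------------------------------------
-- Minors.  The ground set of a minor is the set S of remaining elements,
-- relabelled by Fin ∣ S ∣ in increasing order.  `embed S` undoes the
-- relabelling, turning a subset of Fin ∣ S ∣ into the corresponding
-- subset of S.

embed : (S : Subset n) → Subset ∣ S ∣ → Subset n
embed []            []      = []
embed (inside  ∷ S) (x ∷ X) = x ∷ embed S X
embed (outside ∷ S) X       = outside ∷ embed S X

embed-⊥ : (S : Subset n) → embed S ⊥ ≡ ⊥
embed-⊥ []            = refl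
embed-⊥ (inside  ∷ S) = cong (outside ∷_) (embed-⊥ S)
embed-⊥ (outside ∷ S) = cong (outside ∷_) (embed-⊥ S)

embed-∪ : (S : Subset n) (X Y : Subset ∣ S ∣) →
          embed S (X ∪ Y) ≡ embed S X ∪ embed S Y
embed-∪ []            []      []      = refl
embed-∪ (inside  ∷ S) (x ∷ X) (y ∷ Y) = cong ((x ∨ y) ∷_) (embed-∪ S X Y)
embed-∪ (outside ∷ S) X       Y       = cong (outside ∷_) (embed-∪ S X Y)

embed-∩ : (S : Subset n) (X Y : Subset ∣ S ∣) →
          embed S (X ∩ Y) ≡ embed S X ∩ embed S Y
embed-∩ []            []      []      = refl
embed-∩ (inside  ∷ S) (x ∷ X) (y ∷ Y) = cong ((x ∧ y) ∷_) (embed-∩ S X Y)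
embed-∩ (outside ∷ S) X       Y       = cong (outside ∷_) (embed-∩ S X Y)

embed-⊆ : (S : Subset n) (X Y : Subset ∣ S ∣) →
          X ⊆ Y → embed S X ⊆ embed S Y
embed-⊆ (inside ∷ S) (_ ∷ X) (_ ∷ Y) X⊆Y here with here ← X⊆Y here = here
embed-⊆ (inside ∷ S) (_ ∷ X) (_ ∷ Y) X⊆Y (there i∈X) =
  there (embed-⊆ S X Y (drop-∷-⊆ X⊆Y) i∈X)
embed-⊆ (outside ∷ S) X Y X⊆Y (there i∈X) = there (embed-⊆ S X Y X⊆Y i∈X)

infixl 7 _∖_ _/_

_∖_ : Polymatroid n → (A : Subset n) → Polymatroid ∣ ∁ A ∣
ρ ∖ A = record
  { rank          = λ X → ρ.rank (embed (∁ A) X)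
  ; isPolymatroid = record
    { normalized    = trans (cong ρ.rank (embed-⊥ (∁ A))) ρ.normalized
    ; nonDecreasing = λ X Y X⊆Y → ρ.nonDecreasing _ _ (embed-⊆ (∁ A) X Y X⊆Y)
    ; submodular    = λ X Y →
        subst₂ (λ U V → ρ.rank U + ρ.rank V ≤
                         ρ.rank (embed (∁ A) X) + ρ.rank (embed (∁ A) Y))
          (sym (embed-∪ (∁ A) X Y)) (sym (embed-∩ (∁ A) X Y))
          (ρ.submodular (embed (∁ A) X) (embed (∁ A) Y))
    }
  }
  where module ρ = Polymatroid ρ

_/_ : Polymatroid n → (A : Subset n) → Polymatroid ∣ ∁ A ∣
_/_ {n} ρ A = record
  { rank          = λ X → ρ.rank (embed (∁ A) X ∪ A) - ρ.rank A
  ; isPolymatroid = record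
    { normalized    =
        trans (cong (λ U → ρ.rank U - ρ.rank A)
                (trans (cong (_∪ A) (embed-⊥ (∁ A))) (∪-identityˡ A)))
              (+-inverseʳ (ρ.rank A))
    ; nonDecreasing = λ X Y X⊆Y → +-monoˡ-≤ (- ρ.rank A)
        (ρ.nonDecreasing _ _ λ i∈ → x∈p∪q⁺
          (map₁ (embed-⊆ (∁ A) X Y X⊆Y) (x∈p∪q⁻ (embed (∁ A) X) A i∈)))
    ; submodular    = λ X Y →
        subst₂ _≤_
          (shift (ρ.rank (embed (∁ A) (X ∪ Y) ∪ A)) _ (ρ.rank A))
          (shift (ρ.rank (embed (∁ A) X ∪ A)) _ (ρ.rank A))
          (+-monoˡ-≤ (- ρ.rank A + - ρ.rank A)
            (subst₂ (λ U V → ρ.rank U + ρ.rank V ≤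
                ρ.rank (embed (∁ A) X ∪ A) + ρ.rank (embed (∁ A) Y ∪ A))
              (sym (trans (cong (_∪ A) (embed-∪ (∁ A) X Y))
                          (∪-distribʳ-∪ (embed (∁ A) X) (embed (∁ A) Y))))
              (sym (trans (cong (_∪ A) (embed-∩ (∁ A) X Y))
                          (∪-distribʳ-∩ A (embed (∁ A) X) (embed (∁ A) Y))))
              (ρ.submodular (embed (∁ A) X ∪ A) (embed (∁ A) Y ∪ A))))
    }
  }
  where
  module ρ = Polymatroid ρ
  shift : ∀ a b c → (a + b) + (- c + - c) ≡ (a - c) + (b - c)
  shift = solve-∀
  ∪-distribʳ-∪ : (X Y : Subset n) → (X ∪ Y) ∪ A ≡ (X ∪ A) ∪ (Y ∪ A)
  ∪-distribʳ-∪ X Y = begin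
    (X ∪ Y) ∪ A        ≡⟨ cong ((X ∪ Y) ∪_) (∪-idem A) ⟨
    (X ∪ Y) ∪ (A ∪ A)  ≡⟨ ∪-assoc X Y (A ∪ A) ⟩
    X ∪ (Y ∪ (A ∪ A))  ≡⟨ cong (X ∪_) (∪-assoc Y A A) ⟨
    X ∪ ((Y ∪ A) ∪ A)  ≡⟨ cong (X ∪_) (∪-comm (Y ∪ A) A) ⟩
    X ∪ (A ∪ (Y ∪ A))  ≡⟨ ∪-assoc X A (Y ∪ A) ⟨
    (X ∪ A) ∪ (Y ∪ A)  ∎
    where open ≡-Reasoning

------------------------------------------------------------------------

image : Permutation m n → Subset m → Subset n
image π X = tabulate λ j → lookup X (π ⟨$⟩ˡ j)

IsIsomorphism : Polymatroid m → Polymatroid n → Permutation m n → Set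
IsIsomorphism ρ σ π = ∀ X → rank ρ X ≡ rank σ (image π X)

infix 4 _≅_

_≅_ : Polymatroid m → Polymatroid n → Set
ρ ≅ σ = ∃[ π ] IsIsomorphism ρ σ π

-- B is a subset of the ground set of ρ ∖ A, so it is disjoint from A.
_HasMinor_ : Polymatroid n → Polymatroid m → Set
ρ HasMinor σ = ∃[ A ] ∃[ B ] (ρ ∖ A) / B ≅ σ

-- E(M) is Fin N, so L = M ∖ A and Q = M / A hold after identifying the
-- complement of A with the ground set of L and Q; the identification π
-- must be the same in both equations.
_IsQuotientOf_ : Matroid n → Matroid n → Set
Q IsQuotientOf L =
  ∃[ N ] ∃[ M ] ∃[ A ] ∃[ π ]
    IsIsomorphism (polymatroid {N} M ∖ A) (polymatroid L) π ×
    IsIsomorphism (polymatroid {N} M / A) (polymatroid Q) π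

------------------------------------------------------------------------

∣∪∣+∣∩∣ : (X Y : Subset n) → ∣ X ∪ Y ∣ ℕ.+ ∣ X ∩ Y ∣ ≡ ∣ X ∣ ℕ.+ ∣ Y ∣
∣∪∣+∣∩∣ []            []            = refl
∣∪∣+∣∩∣ (outside ∷ X) (outside ∷ Y) = ∣∪∣+∣∩∣ X Y
∣∪∣+∣∩∣ (inside  ∷ X) (outside ∷ Y) = cong suc (∣∪∣+∣∩∣ X Y)
∣∪∣+∣∩∣ (outside ∷ X) (inside  ∷ Y) =
  trans (cong suc (∣∪∣+∣∩∣ X Y)) (sym (ℕ.+-suc _ _))
∣∪∣+∣∩∣ (inside  ∷ X) (inside  ∷ Y) = cong suc
  (trans (ℕ.+-suc _ _) (trans (cong suc (∣∪∣+∣∩∣ X Y)) (sym (ℕ.+-suc _ _))))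

-- The free matroid U_{n,n}.
freeMatroid : (n : ℕ) → Matroid n
freeMatroid n = record
  { polymatroid = record
    { rank          = λ X → + ∣ X ∣
    ; isPolymatroid = record
      { normalized    = cong +_ (∣⊥∣≡0 n)
      ; nonDecreasing = λ X Y X⊆Y → +≤+ (p⊆q⇒∣p∣≤∣q∣ X⊆Y)
      ; submodular    = λ X Y → +≤+ (ℕ.≤-reflexive (∣∪∣+∣∩∣ X Y))
      }
    }
  ; subcardinal = λ X → ≤-refl
  }

{-# OPTIONS --safe #-}

-- If M₂ is a quotient of M₁, then r M₁ - r M₂ is non-decreasing.  In a free
-- minor of r M₁ + r M₂ every element has rank 1, so it is a loop of the minor
-- of M₂; hence that minor of M₂ has rank 0, and the number of elements is a
-- difference of values of r M₁ - r M₂, so at most r M₁ ⊤ - r M₂ ⊤.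
-- Conversely, a basis B of M₂ is independent in M₁ and extends to a basis J of
-- M₁.  Contracting B and restricting to K with B ⊆ K ⊆ J leaves rank 0 from M₂
-- and a free matroid on K ─ B from M₁.

module Submission where

open import Defs
open import Data.Bool using (true; false)
open import Data.Nat as ℕ using (ℕ; suc; _>_; z≤n; s≤s)
import Data.Nat.Properties as ℕ
open import Data.Integer
  using (+_; 0ℤ; 1ℤ; +≤+; _+_; _-_; _≤_; _≤?_; drop‿+≤+)
open import Data.Integer.Properties
open import Data.Integer.Tactic.RingSolver using (solve-∀)
open import Data.Fin using (Fin; zero; suc)
open import Data.Fin.Permutation as Perm
  using (Permutation; _⟨$⟩ʳ_; _⟨$⟩ˡ_; inverseʳ; flip)
open import Data.Fin.Subset
  using (Subset; inside; outside; _∈_; ⊤; ⊥; ∁; ⁅_⁆; _∪_; _∩_; _─_; _⊆_; ∣_∣)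
open import Data.Fin.Subset.Properties
open import Data.Product using (∃-syntax; _×_; _,_)
open import Data.Sum using (inj₁; inj₂; [_,_]′)
open import Data.Vec using ([]; _∷_; here; there; lookup)
open import Data.Vec.Properties
  using ([]=⇒lookup; lookup⇒[]=; lookup∘tabulate; tabulate∘lookup; tabulate-cong)
open import Function.Base using (_∘_; id)
open import Function.Bundles using (_⇔_; mk⇔)
open import Relation.Nullary using (¬_; yes; no; contradiction)
open import Relation.Binary.PropositionalEquality

open Polymatroid using (rank)

private variable
  k m n : ℕ

-- Integer inequalities.

-- Reduces the rearrangement of an inequality to a ring identity.
≤-by-difference : ∀ {a b c d} → a ≤ b → b - a ≡ d - c → c ≤ d
≤-by-difference a≤b eq = 0≤i-j⇒j≤i (subst (0ℤ ≤_) eq (i≤j⇒0≤j-i a≤b))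

+-cancelʳ-≤ : ∀ c a b → a + c ≤ b + c → a ≤ b
+-cancelʳ-≤ c a b h = ≤-by-difference h (difference a b c)
  where
  difference : ∀ a b c → (b + c) - (a + c) ≡ b - a
  difference = solve-∀

-- Integrality: `x ≥ 1` would force `y + x ≥ x + x ≥ 2`.
x≤y∧y+x≤1⇒x≤0 : ∀ {x y} → x ≤ y → y + x ≤ 1ℤ → x ≤ 0ℤ
x≤y∧y+x≤1⇒x≤0 {x} x≤y y+x≤1 with x ≤? 0ℤ
... | yes x≤0 = x≤0
... | no  x≰0 = contradiction
  (≤-trans (+-mono-≤ 1≤x 1≤x) (≤-trans (+-monoˡ-≤ x x≤y) y+x≤1))
  λ { (+≤+ (s≤s ())) }
  where
  1≤x : 1ℤ ≤ x
  1≤x = i<j⇒suc[i]≤j (≰⇒> x≰0)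

-- Finite subsets and their cardinalities.

subset-ind : (P : Subset n → Set) → P ⊥ → (∀ e X → P X → P (⁅ e ⁆ ∪ X)) →
             ∀ X → P X
subset-ind P base step [] = base
subset-ind P base step (x ∷ X) = add x
  where
  without : P (outside ∷ X)
  without = subset-ind (P ∘ (outside ∷_)) base
    (λ e Y → step (suc e) (outside ∷ Y)) X
  add : ∀ x → P (x ∷ X)
  add false = without
  add true  = subst (P ∘ (inside ∷_)) (∪-identityˡ X) (step zero _ without)

∪-lub : {X Y Z : Subset n} → X ⊆ Z → Y ⊆ Z → X ∪ Y ⊆ Z
∪-lub {X = X} {Y} X⊆Z Y⊆Z = [ X⊆Z , Y⊆Z ]′ ∘ x∈p∪q⁻ X Y

∁-involutive : (X : Subset n) → ∁ (∁ X) ≡ X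
∁-involutive X = ⊆-antisym (x∉∁p⇒x∈p ∘ x∈∁p⇒x∉p) (x∉p⇒x∈∁p ∘ x∈p⇒x∉∁p)

⊆-∪-─ : (J K : Subset n) → J ⊆ K ∪ (J ─ K)
⊆-∪-─ J K {x} x∈J with x ∈? K
... | yes x∈K = x∈p∪q⁺ (inj₁ x∈K)
... | no  x∉K = x∈p∪q⁺ (inj₂ (x∈p∧x∉q⇒x∈p─q x∈J x∉K))

∣p∣+∣q─p∣≡∣q∣ : (p q : Subset n) → p ⊆ q → ∣ p ∣ ℕ.+ ∣ q ─ p ∣ ≡ ∣ q ∣
∣p∣+∣q─p∣≡∣q∣ []            []            _   = refl
∣p∣+∣q─p∣≡∣q∣ (outside ∷ p) (outside ∷ q) p⊆q = ∣p∣+∣q─p∣≡∣q∣ p q (drop-∷-⊆ p⊆q)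
∣p∣+∣q─p∣≡∣q∣ (outside ∷ p) (inside  ∷ q) p⊆q =
  trans (ℕ.+-suc ∣ p ∣ _) (cong suc (∣p∣+∣q─p∣≡∣q∣ p q (drop-∷-⊆ p⊆q)))
∣p∣+∣q─p∣≡∣q∣ (inside  ∷ p) (inside  ∷ q) p⊆q =
  cong suc (∣p∣+∣q─p∣≡∣q∣ p q (drop-∷-⊆ p⊆q))
∣p∣+∣q─p∣≡∣q∣ (inside  ∷ p) (outside ∷ q) p⊆q with () ← p⊆q here

∣⁅e⁆∪p∣≤1+∣p∣ : (e : Fin n) (p : Subset n) → ∣ ⁅ e ⁆ ∪ p ∣ ℕ.≤ suc ∣ p ∣
∣⁅e⁆∪p∣≤1+∣p∣ e p = begin
  ∣ ⁅ e ⁆ ∪ p ∣                      ≤⟨ ℕ.m≤m+n _ _ ⟩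
  ∣ ⁅ e ⁆ ∪ p ∣ ℕ.+ ∣ ⁅ e ⁆ ∩ p ∣    ≡⟨ ∣∪∣+∣∩∣ ⁅ e ⁆ p ⟩
  ∣ ⁅ e ⁆ ∣ ℕ.+ ∣ p ∣                ≡⟨ cong (ℕ._+ ∣ p ∣) (∣⁅x⁆∣≡1 e) ⟩
  suc ∣ p ∣                          ∎
  where open ℕ.≤-Reasoning

intermediate : (B J : Subset n) → B ⊆ J → ∣ B ∣ ℕ.≤ k → k ℕ.≤ ∣ J ∣ →
               ∃[ K ] B ⊆ K × K ⊆ J × ∣ K ∣ ≡ k
intermediate [] [] _ _ z≤n = [] , id , id , refl
intermediate (inside ∷ B) (outside ∷ J) B⊆J _ _ with () ← B⊆J here
intermediate (inside ∷ B) (inside ∷ J) B⊆J (s≤s B≤k) (s≤s k≤J)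
  with K , B⊆K , K⊆J , refl ← intermediate B J (drop-∷-⊆ B⊆J) B≤k k≤J
  = inside ∷ K , s⊆s B⊆K , s⊆s K⊆J , refl
intermediate (outside ∷ B) (outside ∷ J) B⊆J B≤k k≤J
  with K , B⊆K , K⊆J , refl ← intermediate B J (drop-∷-⊆ B⊆J) B≤k k≤J
  = outside ∷ K , s⊆s B⊆K , s⊆s K⊆J , refl
intermediate (outside ∷ B) (inside ∷ J) B⊆J B≤k k≤J with ℕ.m≤n⇒m<n∨m≡n k≤J
-- The front element lies in the larger set only: if that set already has size `k` it is the answer,
-- otherwise this element is dropped.
... | inj₂ refl = inside ∷ J , B⊆J , id , refl
... | inj₁ (s≤s k≤J′)
  with K , B⊆K , K⊆J , refl ← intermediate B J (drop-∷-⊆ B⊆J) B≤k k≤J′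
  = outside ∷ K , s⊆s B⊆K , out⊆ K⊆J , refl

-- Relabelled subsets.

∣embed∣ : (S : Subset n) (X : Subset ∣ S ∣) → ∣ embed S X ∣ ≡ ∣ X ∣
∣embed∣ []            []            = refl
∣embed∣ (inside  ∷ S) (inside  ∷ X) = cong suc (∣embed∣ S X)
∣embed∣ (inside  ∷ S) (outside ∷ X) = ∣embed∣ S X
∣embed∣ (outside ∷ S) X             = ∣embed∣ S X

embed⊆ : (S : Subset n) (X : Subset ∣ S ∣) → embed S X ⊆ S
embed⊆ (inside  ∷ S) (_ ∷ X) here       = here
embed⊆ (inside  ∷ S) (_ ∷ X) (there i∈) = there (embed⊆ S X i∈)
embed⊆ (outside ∷ S) X       (there i∈) = there (embed⊆ S X i∈)

embed-surjective : (S Z : Subset n) → Z ⊆ S → ∃[ X ] embed S X ≡ Z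
embed-surjective [] [] _ = [] , refl
embed-surjective (inside ∷ S) (z ∷ Z) Z⊆S
  with X , refl ← embed-surjective S Z (drop-∷-⊆ Z⊆S) = z ∷ X , refl
embed-surjective (outside ∷ S) (outside ∷ Z) Z⊆S
  with X , refl ← embed-surjective S Z (drop-∷-⊆ Z⊆S) = X , refl
embed-surjective (outside ∷ S) (inside ∷ Z) Z⊆S with () ← Z⊆S here

∣embed-∁∪∣ : (B : Subset n) (X : Subset ∣ ∁ B ∣) →
             ∣ embed (∁ B) X ∪ B ∣ ≡ ∣ X ∣ ℕ.+ ∣ B ∣
∣embed-∁∪∣ []            []            = refl
∣embed-∁∪∣ (outside ∷ B) (inside  ∷ X) = cong suc (∣embed-∁∪∣ B X)
∣embed-∁∪∣ (outside ∷ B) (outside ∷ X) = ∣embed-∁∪∣ B X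
∣embed-∁∪∣ (inside  ∷ B) X with embed (∁ B) X | ∣embed-∁∪∣ B X
... | Y | ih = trans (cong suc ih) (sym (ℕ.+-suc ∣ X ∣ ∣ B ∣))

-- Images under permutations.

∈-image⁺ : (π : Permutation m n) (X : Subset m) {j : Fin n} →
           π ⟨$⟩ˡ j ∈ X → j ∈ image π X
∈-image⁺ π X {j} i∈X =
  lookup⇒[]= j _ (trans (lookup∘tabulate _ j) ([]=⇒lookup i∈X))

∈-image⁻ : (π : Permutation m n) (X : Subset m) {j : Fin n} →
           j ∈ image π X → π ⟨$⟩ˡ j ∈ X
∈-image⁻ π X {j} j∈ =
  lookup⇒[]= _ X (trans (sym (lookup∘tabulate _ j)) ([]=⇒lookup j∈))

image-⊆ : (π : Permutation m n) {X Y : Subset m} → X ⊆ Y → image π X ⊆ image π Y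
image-⊆ π X⊆Y = ∈-image⁺ π _ ∘ X⊆Y ∘ ∈-image⁻ π _

-- Lets a subset of the target of an isomorphism be pulled back to its source.
image-image-flip : (π : Permutation m n) (Y : Subset n) →
                   image π (image (flip π) Y) ≡ Y
image-image-flip π Y = trans
  (tabulate-cong λ j → trans (lookup∘tabulate _ (π ⟨$⟩ˡ j))
                             (cong (lookup Y) (inverseʳ π)))
  (tabulate∘lookup Y)

∣image-⁅⁆∣≤1 : (π : Permutation m n) (e : Fin m) → ∣ image π ⁅ e ⁆ ∣ ℕ.≤ 1
∣image-⁅⁆∣≤1 π e = ℕ.≤-trans (p⊆q⇒∣p∣≤∣q∣ image⊆)
                             (ℕ.≤-reflexive (∣⁅x⁆∣≡1 (π ⟨$⟩ʳ e)))
  where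
  image⊆ : image π ⁅ e ⁆ ⊆ ⁅ π ⟨$⟩ʳ e ⁆
  image⊆ {j} j∈ with refl ← x∈⁅y⁆⇒x≡y e (∈-image⁻ π ⁅ e ⁆ j∈) =
    subst (λ i → j ∈ ⁅ i ⁆) (sym (inverseʳ π)) (x∈⁅x⁆ j)

∣image-⊤∣≥n : (π : Permutation m n) → n ℕ.≤ ∣ image π ⊤ ∣
∣image-⊤∣≥n {n = n} π = ℕ.≤-trans (ℕ.≤-reflexive (sym (∣⊤∣≡n n)))
  (p⊆q⇒∣p∣≤∣q∣ {p = ⊤} {q = image π ⊤} λ {j} _ → ∈-image⁺ π ⊤ {j} ∈⊤)

-- Consequences of submodularity.

-- Monotonicity allows the union and the intersection to be replaced by subsets, so inclusions
-- suffice in place of set equalities.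
submodular-⊆ : (ρ : Polymatroid n) {W J X Y : Subset n} →
               W ⊆ X ∪ Y → J ⊆ X → J ⊆ Y →
               rank ρ W + rank ρ J ≤ rank ρ X + rank ρ Y
submodular-⊆ ρ {X = X} {Y} W⊆ J⊆X J⊆Y = ≤-trans
  (+-mono-≤ (ρ.nonDecreasing _ _ W⊆)
            (ρ.nonDecreasing _ _ λ j → x∈p∩q⁺ (J⊆X j , J⊆Y j)))
  (ρ.submodular X Y)
  where module ρ = Polymatroid ρ

subadditive : (ρ : Polymatroid n) {W X Y : Subset n} →
              W ⊆ X ∪ Y → rank ρ W ≤ rank ρ X + rank ρ Y
subadditive ρ {W} W⊆ = subst (_≤ _)
  (trans (cong (_+_ (rank ρ W)) (Polymatroid.normalized ρ)) (+-identityʳ _))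
  (submodular-⊆ ρ W⊆ (⊆-min _) (⊆-min _))

all-loops⇒rank≤0 : (ρ : Polymatroid n) → (∀ e → rank ρ ⁅ e ⁆ ≤ 0ℤ) →
                   ∀ X → rank ρ X ≤ 0ℤ
all-loops⇒rank≤0 ρ loop = subset-ind (λ X → rank ρ X ≤ 0ℤ)
  (≤-reflexive (Polymatroid.normalized ρ))
  (λ e X ih → ≤-trans (subadditive ρ id) (+-mono-≤ (loop e) ih))

-- Independent sets and bases.

-- Only one inequality is recorded; the opposite one is `subcardinal`.
Independent : Matroid n → Subset n → Set
Independent M I = + ∣ I ∣ ≤ r M I

independent⇒rank≡ : (M : Matroid n) {I : Subset n} → Independent M I →
                    r M I ≡ + ∣ I ∣
independent⇒rank≡ M = ≤-antisym (Matroid.subcardinal M _)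

independent-⊥ : (M : Matroid n) → Independent M ⊥
independent-⊥ {n} M = ≤-reflexive
  (trans (cong +_ (∣⊥∣≡0 n)) (sym (Polymatroid.normalized (polymatroid M))))

-- Passing from `K` to `J` raises the rank by at most `∣ J ─ K ∣`, so a rank deficit in `K` would
-- persist in `J`.
independent-⊆ : (M : Matroid n) {J K : Subset n} → K ⊆ J →
                Independent M J → Independent M K
independent-⊆ M {J} {K} K⊆J indJ = +-cancelʳ-≤ (+ ∣ J ─ K ∣) _ _ (begin
  + ∣ K ∣ + + ∣ J ─ K ∣      ≡⟨ pos-+ ∣ K ∣ ∣ J ─ K ∣ ⟨
  + (∣ K ∣ ℕ.+ ∣ J ─ K ∣)    ≡⟨ cong +_ (∣p∣+∣q─p∣≡∣q∣ K J K⊆J) ⟩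
  + ∣ J ∣                    ≤⟨ indJ ⟩
  r M J                      ≤⟨ subadditive (polymatroid M) (⊆-∪-─ J K) ⟩
  r M K + r M (J ─ K)        ≤⟨ +-monoʳ-≤ (r M K) (Matroid.subcardinal M _) ⟩
  r M K + + ∣ J ─ K ∣        ∎)
  where open ≤-Reasoning

-- Greedy construction along `X`: an element joins `J` exactly when it raises the rank of `J`.
extend-to-spanning : (M : Matroid n) {I : Subset n} → Independent M I → ∀ X →
  ∃[ J ] I ⊆ J × Independent M J × r M (X ∪ J) ≤ r M J
extend-to-spanning M {I} indI = subset-ind _
  (I , id , indI , ≤-reflexive (cong (r M) (∪-identityˡ I)))
  step
  where
  -- Submodularity for `⁅ e ⁆ ∪ J` and `X ∪ J`, whose intersection contains `J`.
  spanned : ∀ e X J → r M (X ∪ J) ≤ r M J →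
            r M ((⁅ e ⁆ ∪ X) ∪ (⁅ e ⁆ ∪ J)) ≤ r M (⁅ e ⁆ ∪ J)
  spanned e X J X≤J = +-cancelʳ-≤ (r M J) _ _ (begin
    r M ((⁅ e ⁆ ∪ X) ∪ (⁅ e ⁆ ∪ J)) + r M J
      ≤⟨ submodular-⊆ (polymatroid M) ⊆-union (q⊆p∪q ⁅ e ⁆ J) (q⊆p∪q X J) ⟩
    r M (⁅ e ⁆ ∪ J) + r M (X ∪ J)
      ≤⟨ +-monoʳ-≤ (r M (⁅ e ⁆ ∪ J)) X≤J ⟩
    r M (⁅ e ⁆ ∪ J) + r M J ∎)
    where
    open ≤-Reasoning
    ⊆-union : (⁅ e ⁆ ∪ X) ∪ (⁅ e ⁆ ∪ J) ⊆ (⁅ e ⁆ ∪ J) ∪ (X ∪ J)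
    ⊆-union = ∪-lub
      (∪-lub (⊆-trans (p⊆p∪q J) (p⊆p∪q _)) (⊆-trans (p⊆p∪q J) (q⊆p∪q _ _)))
      (p⊆p∪q _)
  step : ∀ e X → ∃[ J ] I ⊆ J × Independent M J × r M (X ∪ J) ≤ r M J →
         ∃[ J ] I ⊆ J × Independent M J × r M ((⁅ e ⁆ ∪ X) ∪ J) ≤ r M J
  step e X (J , I⊆J , indJ , X≤J) with r M (⁅ e ⁆ ∪ J) ≤? r M J
  ... | yes e≤J = J , I⊆J , indJ , ≤-trans
    (Polymatroid.nonDecreasing (polymatroid M) _ _
      (∪-lub (p⊆p∪q _) (⊆-trans (q⊆p∪q ⁅ e ⁆ J) (q⊆p∪q _ _))))
    (≤-trans (spanned e X J X≤J) e≤J)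
  -- The rank grows by at least one and the size by at most one, so independence survives.
  ... | no e≰J = ⁅ e ⁆ ∪ J , ⊆-trans I⊆J (q⊆p∪q _ J)
    , ≤-trans (+≤+ (∣⁅e⁆∪p∣≤1+∣p∣ e J))
        (≤-trans (suc-mono indJ) (i<j⇒suc[i]≤j (≰⇒> e≰J)))
    , spanned e X J X≤J

extend-to-basis : (M : Matroid n) {I : Subset n} → Independent M I →
                  ∃[ J ] I ⊆ J × Independent M J × r M ⊤ ≤ r M J
extend-to-basis M indI
  with J , I⊆J , indJ , ⊤∪J≤J ← extend-to-spanning M indI ⊤
  = J , I⊆J , indJ ,
    ≤-trans (Polymatroid.nonDecreasing (polymatroid M) _ _ (p⊆p∪q J)) ⊤∪J≤J

-- Ranks of quotients.

-- Submodularity in `M` for `lift Y` and `lift X ∪ A`: the union contains `lift Y ∪ A`, the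
-- intersection contains `lift X`. Subtracting `r M A` on both sides shows that `r L - r Q` is
-- non-decreasing.
rank-increment-quotient : {L Q : Matroid n} → Q IsQuotientOf L →
                          ∀ {X Y} → X ⊆ Y → r Q Y + r L X ≤ r L Y + r Q X
rank-increment-quotient {L = L} {Q} (N , M , A , π , isoL , isoQ) {X} {Y} X⊆Y =
  subst₂ _≤_ (cong₂ _+_ (rQ Y) (rL X)) (cong₂ _+_ (rL Y) (rQ X))
    (≤-by-difference
      (submodular-⊆ (polymatroid M)
        (∪-lub (p⊆p∪q _) (⊆-trans (q⊆p∪q _ A) (q⊆p∪q _ _)))
        (embed-⊆ (∁ A) _ _ (image-⊆ (flip π) X⊆Y))
        (p⊆p∪q A))
      (difference (r M (lift Y ∪ A)) (r M (lift X)) (r M (lift Y))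
                  (r M (lift X ∪ A)) (r M A)))
  where
  lift : Subset _ → Subset N
  lift Z = embed (∁ A) (image (flip π) Z)
  rL : ∀ Z → r M (lift Z) ≡ r L Z
  rL Z = trans (isoL _) (cong (r L) (image-image-flip π Z))
  rQ : ∀ Z → r M (lift Z ∪ A) - r M A ≡ r Q Z
  rQ Z = trans (isoQ _) (cong (r Q) (image-image-flip π Z))
  difference : ∀ yA x y xA a →
    (y + xA) - (yA + x) ≡ (y + (xA - a)) - ((yA - a) + x)
  difference = solve-∀


-- The increment from `⊥`, where both ranks vanish.
quotient-rank-≤ : {L Q : Matroid n} → Q IsQuotientOf L → ∀ X → r Q X ≤ r L X
quotient-rank-≤ {L = L} {Q} quotient X = subst₂ _≤_
  (plus-zero (Polymatroid.normalized (polymatroid L)))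
  (plus-zero (Polymatroid.normalized (polymatroid Q)))
  (rank-increment-quotient {L = L} {Q} quotient (⊆-min X))
  where
  plus-zero : ∀ {a b} → b ≡ 0ℤ → a + b ≡ a
  plus-zero refl = +-identityʳ _

-- From a free minor to a rank gap.

free-minor⇒≤ : (M₁ M₂ : Matroid n) → M₂ IsQuotientOf M₁ →
  (polymatroid M₁ ⊕ polymatroid M₂) HasMinor polymatroid (freeMatroid k) →
  + k ≤ r M₁ ⊤ - r M₂ ⊤
free-minor⇒≤ {k = k} M₁ M₂ quotient (A , C , π , iso) = begin
  + k                      ≤⟨ +≤+ (∣image-⊤∣≥n π) ⟩
  + ∣ image π ⊤ ∣          ≡⟨ sum ⊤ ⟨
  -- With `d = r M₁ - r M₂`, the left side is `d (Z ⊤) - d B` plus twice `rank μ₂ ⊤`. Here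
  -- `d (Z ⊤) ≤ d ⊤`, `d B ≥ 0` and `rank μ₂ ⊤ ≤ 0`, the last used twice.
  rank μ₁ ⊤ + rank μ₂ ⊤    ≤⟨ ≤-by-difference
    (+-mono-≤ (+-mono-≤ μ₂⊤≤0 μ₂⊤≤0)
      (+-mono-≤ (increment (⊆-max (Z ⊤))) (quotient-rank-≤ {L = M₁} {M₂} quotient B)))
    (bound (r M₁ (Z ⊤)) (r M₁ B) (r M₂ (Z ⊤)) (r M₂ B) (r M₁ ⊤) (r M₂ ⊤)) ⟩
  r M₁ ⊤ - r M₂ ⊤          ∎
  where
  open ≤-Reasoning
  increment : ∀ {X Y} → X ⊆ Y → r M₂ Y + r M₁ X ≤ r M₁ Y + r M₂ X
  increment = rank-increment-quotient {L = M₁} {M₂} quotient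
  B = embed (∁ A) C
  Z : Subset ∣ ∁ C ∣ → Subset _
  Z X = embed (∁ A) (embed (∁ C) X ∪ C)
  μ₁ = polymatroid M₁ ∖ A / C
  μ₂ = polymatroid M₂ ∖ A / C
  -- Taking minors commutes with sums, so `iso` evaluates the sum of the separate minors.
  sum : ∀ X → rank μ₁ X + rank μ₂ X ≡ + ∣ image π X ∣
  sum X = trans (interchange (r M₁ (Z X)) (r M₁ B) (r M₂ (Z X)) (r M₂ B)) (iso X)
    where
    interchange : ∀ a b c d → (a - b) + (c - d) ≡ (a + c) - (b + d)
    interchange = solve-∀
  μ₂≤μ₁ : ∀ X → rank μ₂ X ≤ rank μ₁ X
  μ₂≤μ₁ X = ≤-by-difference
    (increment (embed-⊆ (∁ A) C _ (q⊆p∪q (embed (∁ C) X) C)))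
    (difference (r M₁ (Z X)) (r M₁ B) (r M₂ (Z X)) (r M₂ B))
    where
    difference : ∀ z₁ b₁ z₂ b₂ → (z₁ + b₂) - (z₂ + b₁) ≡ (z₁ - b₁) - (z₂ - b₂)
    difference = solve-∀
  -- On a singleton the two ranks sum to at most 1 and that of `μ₂` is not the larger, so by
  -- integrality every element is a loop of `μ₂`.
  μ₂⊤≤0 : rank μ₂ ⊤ ≤ 0ℤ
  μ₂⊤≤0 = all-loops⇒rank≤0 μ₂
    (λ e → x≤y∧y+x≤1⇒x≤0 (μ₂≤μ₁ ⁅ e ⁆)
      (≤-trans (≤-reflexive (sum ⁅ e ⁆)) (+≤+ (∣image-⁅⁆∣≤1 π e))))
    ⊤
  bound : ∀ z₁ b₁ z₂ b₂ t₁ t₂ →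
    ((0ℤ + 0ℤ) + ((t₁ + z₂) + b₁))
      - (((z₂ - b₂) + (z₂ - b₂)) + ((t₂ + z₁) + b₂))
    ≡ (t₁ - t₂) - ((z₁ - b₁) + (z₂ - b₂))
  bound = solve-∀

-- From a rank gap to a free minor.

cardinality⇒≅-free : (ρ : Polymatroid m) → m ≡ k → (∀ X → rank ρ X ≡ + ∣ X ∣) →
                     ρ ≅ polymatroid (freeMatroid k)
cardinality⇒≅-free ρ refl rank≡ =
  Perm.id , λ X → trans (rank≡ X) (cong (λ Y → + ∣ Y ∣) (sym (tabulate∘lookup X)))

-- The contracted set spans `M₂`, so `M₂` contributes 0; `∁ A` is independent in `M₁`, so `M₁`
-- contributes a difference of sizes.
spanned-minor-rank : (M₁ M₂ : Matroid n) (A : Subset n) (C : Subset ∣ ∁ A ∣) →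
  Independent M₁ (∁ A) → r M₂ ⊤ ≤ r M₂ (embed (∁ A) C) →
  ∀ X → rank ((polymatroid M₁ ⊕ polymatroid M₂) ∖ A / C) X ≡ + ∣ X ∣
spanned-minor-rank M₁ M₂ A C ind spanning X = begin
  (r M₁ Z + r M₂ Z) - (r M₁ B + r M₂ B)
    ≡⟨ cong (λ a → (r M₁ Z + a) - (r M₁ B + r M₂ B)) (≤-antisym Z≤B B≤Z) ⟩
  (r M₁ Z + r M₂ B) - (r M₁ B + r M₂ B)
    ≡⟨ cong₂ (λ a b → (a + r M₂ B) - (b + r M₂ B)) (rank₁ _) (rank₁ C) ⟩
  (+ ∣ embed (∁ C) X ∪ C ∣ + r M₂ B) - (+ ∣ C ∣ + r M₂ B)
    ≡⟨ cong (λ a → (a + r M₂ B) - (+ ∣ C ∣ + r M₂ B))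
         (trans (cong +_ (∣embed-∁∪∣ C X)) (pos-+ ∣ X ∣ ∣ C ∣)) ⟩
  ((+ ∣ X ∣ + + ∣ C ∣) + r M₂ B) - (+ ∣ C ∣ + r M₂ B)
    ≡⟨ cancel (+ ∣ X ∣) (+ ∣ C ∣) (r M₂ B) ⟩
  + ∣ X ∣ ∎
  where
  open ≡-Reasoning
  B = embed (∁ A) C
  Z = embed (∁ A) (embed (∁ C) X ∪ C)
  module M₂ = Polymatroid (polymatroid M₂)
  Z≤B : r M₂ Z ≤ r M₂ B
  Z≤B = ≤-trans (M₂.nonDecreasing _ _ (⊆-max Z)) spanning
  B≤Z : r M₂ B ≤ r M₂ Z
  B≤Z = M₂.nonDecreasing _ _ (embed-⊆ (∁ A) C _ (q⊆p∪q (embed (∁ C) X) C))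
  rank₁ : ∀ Y → r M₁ (embed (∁ A) Y) ≡ + ∣ Y ∣
  rank₁ Y = trans
    (independent⇒rank≡ M₁ (independent-⊆ M₁ (embed⊆ (∁ A) Y) ind))
    (cong +_ (∣embed∣ (∁ A) Y))
  cancel : ∀ x c b → ((x + c) + b) - (c + b) ≡ x
  cancel = solve-∀

-- Ensures room between `B` and `J` for a set with `k` elements beyond `B`.
independent+k≤spanning : (M₁ M₂ : Matroid n) (B J : Subset n) →
  + k ≤ r M₁ ⊤ - r M₂ ⊤ →
  Independent M₂ B → r M₁ ⊤ ≤ r M₁ J → ∣ B ∣ ℕ.+ k ℕ.≤ ∣ J ∣
independent+k≤spanning {k = k} M₁ M₂ B J k≤ ind₂ J-spanning = drop‿+≤+ (begin
  + (∣ B ∣ ℕ.+ k)                ≡⟨ pos-+ ∣ B ∣ k ⟩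
  + ∣ B ∣ + + k                  ≤⟨ +-mono-≤ ind₂ k≤ ⟩
  r M₂ B + (r M₁ ⊤ - r M₂ ⊤)     ≤⟨ +-monoˡ-≤ _
    (Polymatroid.nonDecreasing (polymatroid M₂) _ _ (⊆-max B)) ⟩
  r M₂ ⊤ + (r M₁ ⊤ - r M₂ ⊤)     ≡⟨ cancel (r M₁ ⊤) (r M₂ ⊤) ⟩
  r M₁ ⊤                         ≤⟨ J-spanning ⟩
  r M₁ J                         ≤⟨ Matroid.subcardinal M₁ J ⟩
  + ∣ J ∣                        ∎)
  where
  open ≤-Reasoning
  cancel : ∀ a b → b + (a - b) ≡ a
  cancel = solve-∀

-- Counts the ground set of the minor. Restriction to `K` is deletion of `∁ K`, whence the double
-- complement.
∣K∣≡∣embed∣+k⇒∣∁∣≡k : (K : Subset n) (C : Subset ∣ ∁ (∁ K) ∣) →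
  ∣ K ∣ ≡ ∣ embed (∁ (∁ K)) C ∣ ℕ.+ k → ∣ ∁ C ∣ ≡ k
∣K∣≡∣embed∣+k⇒∣∁∣≡k {k = k} K C ∣K∣ = begin
  ∣ ∁ C ∣
    ≡⟨ ∣∁p∣≡n∸∣p∣ C ⟩
  ∣ ∁ (∁ K) ∣ ℕ.∸ ∣ C ∣
    ≡⟨ cong (λ X → ∣ X ∣ ℕ.∸ ∣ C ∣) (∁-involutive K) ⟩
  ∣ K ∣ ℕ.∸ ∣ C ∣
    ≡⟨ cong (ℕ._∸ ∣ C ∣) ∣K∣ ⟩
  ∣ embed (∁ (∁ K)) C ∣ ℕ.+ k ℕ.∸ ∣ C ∣
    ≡⟨ cong (λ c → c ℕ.+ k ℕ.∸ ∣ C ∣) (∣embed∣ (∁ (∁ K)) C) ⟩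
  ∣ C ∣ ℕ.+ k ℕ.∸ ∣ C ∣
    ≡⟨ ℕ.m+n∸m≡n ∣ C ∣ k ⟩
  k ∎
  where open ≡-Reasoning

≤⇒free-minor : (M₁ M₂ : Matroid n) → M₂ IsQuotientOf M₁ →
  + k ≤ r M₁ ⊤ - r M₂ ⊤ →
  (polymatroid M₁ ⊕ polymatroid M₂) HasMinor polymatroid (freeMatroid k)
≤⇒free-minor {k = k} M₁ M₂ quotient k≤ =
  let
    B , _ , ind₂ , B-spanning = extend-to-basis M₂ (independent-⊥ M₂)
    -- `B` is independent in `M₁` too, because ranks in `M₁` are at least those in `M₂`.
    J , B⊆J , indJ , J-spanning = extend-to-basis M₁
      (≤-trans ind₂ (quotient-rank-≤ {L = M₁} {M₂} quotient B))
    K , B⊆K , K⊆J , ∣K∣ = intermediate B J B⊆J (ℕ.m≤m+n ∣ B ∣ k)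
      (independent+k≤spanning M₁ M₂ B J k≤ ind₂ J-spanning)
    -- `C` is `B` relabelled inside `K`, as contraction follows deletion.
    C , C≡B = embed-surjective (∁ (∁ K)) B
      (subst (B ⊆_) (sym (∁-involutive K)) B⊆K)
  in ∁ K , C , cardinality⇒≅-free
    ((polymatroid M₁ ⊕ polymatroid M₂) ∖ ∁ K / C)
    (∣K∣≡∣embed∣+k⇒∣∁∣≡k K C (trans ∣K∣ (cong (λ X → ∣ X ∣ ℕ.+ k) (sym C≡B))))
    (spanned-minor-rank M₁ M₂ (∁ K) C
      (subst (Independent M₁) (sym (∁-involutive K)) (independent-⊆ M₁ K⊆J indJ))
      (subst (λ X → r M₂ ⊤ ≤ r M₂ X) (sym C≡B) B-spanning))

theorem5p4 : (t : ℕ) → t > 0 → (n : ℕ) (M₁ M₂ : Matroid n) → M₂ IsQuotientOf M₁ →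
    (r M₁ ⊤ - r M₂ ⊤ ≤ + t) ⇔
    (¬ ((polymatroid M₁ ⊕ polymatroid M₂) HasMinor polymatroid (freeMatroid (suc t))))
theorem5p4 t _ n M₁ M₂ quotient = mk⇔
  (λ δ≤t minor → ℕ.1+n≰n
    (drop‿+≤+ (≤-trans (free-minor⇒≤ M₁ M₂ quotient minor) δ≤t)))
  -- Over the integers, a gap above `t` is at least `suc t`, the size of the forbidden minor.
  (λ ¬minor → ≮⇒≥ λ t<δ →
    ¬minor (≤⇒free-minor M₁ M₂ quotient (i<j⇒suc[i]≤j t<δ)))
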